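{- The frame property of symmetry is definable in $\mathcal{L}(\circ)$: there is an $\mathcal{L}(\circ)$-formula $\phi$ such that for every frame $\mathcal{F}=\langle S,R\rangle$, $\mathcal{F}\vDash\phi$ if and only if $R$ is symmetric, i.e. $\forall x\forall y(xRy\to yRx)$.
   Context: Let $\mathbf{P}$ be a nonempty set of propositional variables. The language $\mathcal{L}(\circ)$ is given by $\phi::=p\mid\neg\phi\mid(\phi\land\phi)\mid\circ\phi$ with $p\in\mathbf{P}$; other Boolean connectives are the usual abbreviations. A frame is $\mathcal{F}=\langle S,R\rangle$ with $S$ a nonempty set and $R\subseteq S\times S$; a model based on $\mathcal{F}$ is $\mathcal{M}=\langle S,R,V\rangle$ with $V:\mathbf{P}\to\mathcal{P}(S)$. Satisfaction: $\mathcal{M},s\vDash p$ iff $s\in V(p)$; Booleans as usual; $\mathcal{M},s\vDash\circ\phi$ iff ($\mathcal{M},s\vDash\phi$ implies that $\mathcal{M},t\vDash\phi$ for all $t$ with $sRt$). $\mathcal{F}\vDash\phi$ means $\mathcal{M},s\vDash\phi$ for every model $\mathcal{M}$ based on $\mathcal{F}$ and every $s\in S$. -}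

module Defs where

open import Level using (Level; suc; _⊔_)
open import Data.Product using (_×_)
open import Relation.Binary.Core using (Rel)
open import Relation.Nullary.Negation using (¬_)
open import Relation.Unary using (Pred)

private
  variable
    p ℓ : Level

infix  30 ~_ ∘_
infixr 25 _∧_

data Formula (P : Set p) : Set p where
  var : P → Formula P
  ~_  : Formula P → Formula P
  _∧_ : Formula P → Formula P → Formula P
  ∘_  : Formula P → Formula P

record Frame (ℓ : Level) : Set (suc ℓ) where
  field
    S        : Set ℓ
    nonempty : S
    R        : Rel S ℓ

record Model (P : Set p) (F : Frame ℓ) : Set (p ⊔ suc ℓ) where
  open Frame F
  field
    V : P → Pred S ℓ

module _ {P : Set p} {F : Frame ℓ} (M : Model P F) where
  open Frame F
  open Model M

  Sat : S → Formula P → Set ℓ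
  Sat s (var q) = V q s
  Sat s (~ φ)   = ¬ Sat s φ
  Sat s (φ ∧ ψ) = Sat s φ × Sat s ψ
  Sat s (∘ φ)   = Sat s φ → ∀ t → R s t → Sat t φ

infix 4 _,_⊨_ _⊨_

_,_⊨_ : {P : Set p} {F : Frame ℓ} → Model P F → Frame.S F → Formula P → Set ℓ
M , s ⊨ φ = Sat M s φ

_⊨_ : {P : Set p} → Frame ℓ → Formula P → Set (p ⊔ suc ℓ)
_⊨_ {P = P} F φ = (M : Model P F) (s : Frame.S F) → M , s ⊨ φ

{-# OPTIONS --safe #-}

-- The formula is p → ∘(∘¬p → p). If R is symmetric and s ⊨ p, then a successor t of s with t ⊨ ¬p
-- sees s, so ∘¬p fails at t. Conversely, if s R t but not t R s, then t ≠ s, and making p true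
-- exactly at s refutes the formula at s.
module Submission where

open import Defs
open import Level using (Level)
open import Data.Product using (Σ-syntax; _,_)
open import Function.Bundles using (_⇔_; mk⇔)
open import Relation.Binary.Definitions using (Symmetric)
open import Relation.Binary.PropositionalEquality using (_≡_; refl; sym; subst)
open import Relation.Nullary.Decidable using (decidable-stable)
open import Axiom.ExcludedMiddle using (ExcludedMiddle)

private
  variable
    p ℓ : Level
    P : Set p

-- Each implication φ → ψ is encoded as `~ (φ ∧ ~ ψ)`.
symmetryFormula : P → Formula P
symmetryFormula q = ~ (var q ∧ ~ ∘ ~ (∘ ~ var q ∧ ~ var q))

symmetric⇒valid : (q : P) (F : Frame ℓ) → Symmetric (Frame.R F) → F ⊨ symmetryFormula q
symmetric⇒valid q F R-sym M s (s⊨q , s⊭∘) =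
  s⊭∘ λ _ t sRt (t⊨∘¬q , t⊭q) → t⊨∘¬q t⊭q s (R-sym sRt) s⊨q

valid⇒symmetric : ExcludedMiddle ℓ → (q : P) (F : Frame ℓ) →
  F ⊨ symmetryFormula q → Symmetric (Frame.R F)
-- Excluded middle serves only to strip the double negation from tRs.
valid⇒symmetric em q F valid {s} {t} sRt = decidable-stable em λ ¬tRs →
  valid (record { V = λ _ x → x ≡ s }) s
    ( refl
    -- The inner implication holds at s because its consequent does, so `∘` carries it over to t.
    , λ s⊨∘ → s⊨∘ (λ (_ , s≢s) → s≢s refl) t sRt
        ( (λ _ u tRu u≡s → ¬tRs (subst (R t) u≡s tRu))
        -- If t were s, then sRt would be a loop, which is its own converse.
        , λ t≡s → ¬tRs (subst (λ x → R x s) (sym t≡s) (subst (R s) t≡s sRt))))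
  where open Frame F

proposition10 : ∀ {p ℓ : Level} → ExcludedMiddle ℓ → (P : Set p) → P →
    Σ[ φ ∈ Formula P ] ((F : Frame ℓ) → (F ⊨ φ) ⇔ Symmetric (Frame.R F))
proposition10 em P q =
  symmetryFormula q , λ F → mk⇔ (valid⇒symmetric em q F) (symmetric⇒valid q F)
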